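{- Let $L$ be a complete lattice. The following statements are equivalent: (1) $L$ is join continuous and hypercontinuous. (2) $L$ is prime continuous.
   Context: Let $L$ be a complete lattice. For $y\in L$ and $S\subseteq L$ write $\uparrow y=\{z\in L\mid y\le z\}$ and $\downarrow S=\{z\in L\mid \exists s\in S,\ z\le s\}$. A subset $U\subseteq L$ is upper if $u\in U$ and $u\le p$ imply $p\in U$. $L$ is join continuous if for all $x\in L$ and all $S\subseteq L$, $x\vee\bigwedge S=\bigwedge\{x\vee s\mid s\in S\}$. For $x,y\in L$ write $x\prec y$ if whenever the intersection of a nonempty collection of upper subsets of $L$ is contained in $\uparrow y$, then the intersection of finitely many members of that collection is contained in $\uparrow x$. $L$ is hypercontinuous if $y=\bigvee\{x\in L\mid x\prec y\}$ for all $y\in L$. For $u,v\in L$ write $u\triangleleft v$ if for every $S\subseteq L$, $\bigvee S\ge v$ implies $u\in\downarrow S$. $L$ is prime continuous if $v=\bigvee\{u\in L\mid u\triangleleft v\}$ for all $v\in L$. -}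

module Defs where

open import Data.Fin.Base using (Fin)
open import Data.Nat.Base using (ℕ)
open import Data.Product.Base using (Σ; ∃; _×_; proj₁)
open import Function.Base using (flip)
open import Level using (Level; _⊔_; suc)
open import Relation.Binary.Core using (Rel)
open import Relation.Binary.Lattice.Bundles using (Lattice)
open import Relation.Unary using (Pred; _∈_; _⊆_; Satisfiable; ⋂)

IsLub : ∀ {a r p} {A : Set a} → Rel A r → Pred A p → A → Set (a ⊔ r ⊔ p)
IsLub _≤_ S x = (∀ {s} → s ∈ S → s ≤ x)
              × (∀ b → (∀ {s} → s ∈ S → s ≤ b) → x ≤ b)

IsGlb : ∀ {a r p} {A : Set a} → Rel A r → Pred A p → A → Set (a ⊔ r ⊔ p)
IsGlb _≤_ = IsLub (flip _≤_)

-- Subsets are arbitrary predicates; they need not respect _≈_, since a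
-- predicate and its closure under _≈_ have the same bounds.
record CompleteLattice (c ℓ₁ ℓ₂ : Level) : Set (suc (c ⊔ ℓ₁ ⊔ ℓ₂)) where
  field
    lattice : Lattice c ℓ₁ ℓ₂

  open Lattice lattice public

  Subset : Set (suc (c ⊔ ℓ₁ ⊔ ℓ₂))
  Subset = Pred Carrier (c ⊔ ℓ₁ ⊔ ℓ₂)

  field
    ⋁ ⋀ : Subset → Carrier
    ⋁-isLub : ∀ S → IsLub _≤_ S (⋁ S)
    ⋀-isGlb : ∀ S → IsGlb _≤_ S (⋀ S)

module _ {c ℓ₁ ℓ₂ : Level} (L : CompleteLattice c ℓ₁ ℓ₂) where
  open CompleteLattice L

  ↑ : Carrier → Pred Carrier ℓ₂
  ↑ y z = y ≤ z

  ↓ : Subset → Subset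
  ↓ S z = ∃ λ s → s ∈ S × z ≤ s

  IsUpper : Subset → Set (c ⊔ ℓ₁ ⊔ ℓ₂)
  IsUpper U = ∀ {u p} → u ∈ U → u ≤ p → p ∈ U

  JoinContinuous : Set (suc (c ⊔ ℓ₁ ⊔ ℓ₂))
  JoinContinuous = ∀ (x : Carrier) (S : Subset) →
    x ∨ ⋀ S ≈ ⋀ (λ z → ∃ λ s → s ∈ S × z ≈ x ∨ s)

  -- A finite choice of members is a family V : Fin n → Subset.  The case
  -- n = 0, whose intersection is all of L, is harmless because the
  -- collection is nonempty: any single member then has a smaller intersection.
  _≺_ : Rel Carrier (suc (c ⊔ ℓ₁ ⊔ ℓ₂))
  x ≺ y =
    ∀ (𝒰 : Pred Subset (c ⊔ ℓ₁ ⊔ ℓ₂)) →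
    Satisfiable 𝒰 → (∀ {U} → U ∈ 𝒰 → IsUpper U) →
    ⋂ (∃ 𝒰) proj₁ ⊆ ↑ y →
    Σ ℕ λ n → Σ (Fin n → Subset) λ V →
      (∀ i → V i ∈ 𝒰) × ⋂ (Fin n) V ⊆ ↑ x

  -- The set of all x with x ≺ y quantifies over collections of subsets, so it
  -- lives one universe above Subset and y = ⋁ { x ∣ x ≺ y } is stated by
  -- saying that y is its least upper bound.  The same applies to _◁_ below.
  Hypercontinuous : Set (suc (c ⊔ ℓ₁ ⊔ ℓ₂))
  Hypercontinuous = ∀ y → IsLub _≤_ (λ x → x ≺ y) y

  _◁_ : Rel Carrier (suc (c ⊔ ℓ₁ ⊔ ℓ₂))
  u ◁ v = ∀ (S : Subset) → v ≤ ⋁ S → u ∈ ↓ S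

  PrimeContinuous : Set (suc (c ⊔ ℓ₁ ⊔ ℓ₂))
  PrimeContinuous = ∀ v → IsLub _≤_ (λ u → u ◁ v) v

{-# OPTIONS --safe #-}

-- Classically, u ◁ v amounts to a single m ≱ v that lies above every
-- z ≱ u, whereas x ≺ y amounts to finitely many f₁, …, fₙ ≱ y such that every
-- z ≱ x lies below some fᵢ.  So ◁ implies ≺.  Conversely, by join continuity
-- finite joins distribute over arbitrary meets, hence x ≤ ⋁ᵢ ⋀ (L ∖ ↓ fᵢ), and
-- each ⋀ (L ∖ ↓ fᵢ) ◁ y.
module Submission where

open import Axiom.DoubleNegationElimination using (DoubleNegationElimination; em⇒dne)
open import Axiom.ExcludedMiddle using (ExcludedMiddle)
open import Data.Empty using (⊥-elim)
open import Data.Fin.Base as Fin using (Fin)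
open import Data.Nat.Base as ℕ using (ℕ)
open import Data.Product.Base using (∃; _×_; _,_; proj₁; proj₂)
open import Data.Sum.Base using (_⊎_; inj₁; inj₂)
open import Function.Base using (_∘_)
open import Function.Bundles using (_⇔_; mk⇔)
open import Level using (Level; _⊔_; suc; Lift; lift; lower)
open import Relation.Nullary using (¬_)
open import Relation.Unary using (Pred; _∈_; ⋂)
open import Defs

dne-lower : ∀ {p} q → DoubleNegationElimination (p ⊔ q) → DoubleNegationElimination p
dne-lower q dne ¬¬P = lower (dne {Lift q _} λ ¬P → ¬¬P (¬P ∘ lift))

module _ {c ℓ₁ ℓ₂ : Level} (L : CompleteLattice c ℓ₁ ℓ₂) where
  open CompleteLattice L

  private
    ℓ : Level
    ℓ = c ⊔ ℓ₁ ⊔ ℓ₂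

    infix 4 _◁ᴸ_ _≺ᴸ_

    _◁ᴸ_ _≺ᴸ_ : Carrier → Carrier → Set (suc ℓ)
    _◁ᴸ_ = _◁_ L
    _≺ᴸ_ = _≺_ L

  ⋀-lower : ∀ (S : Subset) {s} → s ∈ S → ⋀ S ≤ s
  ⋀-lower S = proj₁ (⋀-isGlb S)

  ⋀-greatest : ∀ (S : Subset) {b} → (∀ {s} → s ∈ S → b ≤ s) → b ≤ ⋀ S
  ⋀-greatest S = proj₂ (⋀-isGlb S) _

  ⋁-upper : ∀ (S : Subset) {s} → s ∈ S → s ≤ ⋁ S
  ⋁-upper S = proj₁ (⋁-isLub S)

  ⋁-least : ∀ (S : Subset) {b} → (∀ {s} → s ∈ S → s ≤ b) → ⋁ S ≤ b
  ⋁-least S = proj₂ (⋁-isLub S) _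

  ◁⇒≤ : ∀ {u v} → u ◁ᴸ v → u ≤ v
  ◁⇒≤ {u} {v} u◁v with u◁v (λ z → Lift ℓ (z ≤ v)) (⋁-upper _ (lift refl))
  ... | _ , lift s≤v , u≤s = trans u≤s s≤v

  -- Test `x≺y` on all upper sets containing `y`. The principal one is among them, and `y` lies in
  -- every finite intersection.
  ≺⇒≤ : ∀ {x y} → x ≺ᴸ y → x ≤ y
  ≺⇒≤ {x} {y} x≺y
    with x≺y (λ U → IsUpper L U × y ∈ U)
             (↑y , ↑y-upper , lift refl) proj₁ (λ z∈⋂ → lower (z∈⋂ (↑y , ↑y-upper , lift refl)))
    where
    ↑y : Subset
    ↑y z = Lift ℓ (y ≤ z)
    ↑y-upper : IsUpper L ↑y
    ↑y-upper (lift y≤u) u≤p = lift (trans y≤u u≤p)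
  ... | _ , _ , V∋y , ⋂V⊆↑x = ⋂V⊆↑x (proj₂ ∘ V∋y)

  -- That x ≤ ⋁ᵢ ⋀ Vᵢ, with the finite join replaced by an arbitrary upper bound b;
  -- letting b grow to b ∨ s for s ∈ V₀ makes the induction on n go through.
  ⋂⊆↑⇒≤-bound : JoinContinuous L → ∀ {x} n (V : Fin n → Subset) →
    (∀ i → IsUpper L (V i)) → ∀ {b} → (∀ i → ⋀ (V i) ≤ b) →
    (∀ {a} → b ≤ a → a ∈ ⋂ (Fin n) V → x ≤ a) → x ≤ b
  ⋂⊆↑⇒≤-bound jc ℕ.zero V upper ⋀V≤b above = above refl (λ ())
  ⋂⊆↑⇒≤-bound jc {x} (ℕ.suc n) V upper {b} ⋀V≤b above =
    -- As `⋀ (V Fin.zero) ≤ b`, join continuity presents `b` as the meet of all `b ∨ s` with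
    -- `s ∈ V Fin.zero`.
    trans (⋀-greatest _ x≤b∨s)
      (trans (reflexive (Eq.sym (jc b (V Fin.zero)))) (∨-least refl (⋀V≤b Fin.zero)))
    where
    x≤b∨s : ∀ {z} → (∃ λ s → s ∈ V Fin.zero × z ≈ b ∨ s) → x ≤ z
    x≤b∨s (s , s∈V₀ , z≈b∨s) = trans
      (⋂⊆↑⇒≤-bound jc n (V ∘ Fin.suc) (upper ∘ Fin.suc)
        (λ i → trans (⋀V≤b (Fin.suc i)) (x≤x∨y b s))
        λ b∨s≤a a∈⋂ → above (trans (x≤x∨y b s) b∨s≤a) λ where
          Fin.zero    → upper Fin.zero s∈V₀ (trans (y≤x∨y b s) b∨s≤a)
          (Fin.suc i) → a∈⋂ i)
      (reflexive (Eq.sym z≈b∨s))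

  module _ (em : ExcludedMiddle (suc ℓ)) where

    private
      dne : DoubleNegationElimination (suc ℓ)
      dne = em⇒dne em

      dne₂ : DoubleNegationElimination ℓ₂
      dne₂ = dne-lower (suc ℓ) dne

      dneˡ : DoubleNegationElimination ℓ
      dneˡ = dne-lower (suc ℓ) dne

    -- If every `s ∈ S` were below `f`, then `v ≤ ⋁ S ≤ f`. So some `s ∈ S` lies in `U`, hence above
    -- `⋀ U`.
    ⋀∁↓-◁ : ∀ {f v} (U : Subset) → ¬ v ≤ f → (∀ {z} → ¬ z ≤ f → z ∈ U) → ⋀ U ◁ᴸ v
    ⋀∁↓-◁ U v≰f ∁↓f⊆U S v≤⋁S = dneˡ λ ⋀U∉↓S → v≰f (trans v≤⋁S
      (⋁-least S λ {s} s∈S → dne₂ λ s≰f → ⋀U∉↓S (s , s∈S , ⋀-lower U (∁↓f⊆U s≰f))))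

    ≺-bound : JoinContinuous L → ∀ {x v b} →
      (∀ {u} → u ◁ᴸ v → u ≤ b) → x ≺ᴸ v → ¬ v ≤ b → x ≤ b
    ≺-bound jc {x} {v} {b} ◁⊆↓b x≺v v≰b =
      -- The assumption `v≰b` serves only to make the collection nonempty.
      let n , V , V∈𝒰 , ⋂V⊆↑x = x≺v 𝒰 (∁↓ b , ∁↓∈𝒰 v≰b) (proj₁ ∘ proj₂ ∘ proj₂)
            λ {z} z∈⋂ → dne₂ λ v≰z → lower (z∈⋂ (∁↓ z , ∁↓∈𝒰 v≰z)) refl
      in ⋂⊆↑⇒≤-bound jc n V (proj₁ ∘ proj₂ ∘ proj₂ ∘ V∈𝒰)
           (λ i → let _ , v≰f , _ , ∁↓f⊆V = V∈𝒰 i in ◁⊆↓b (⋀∁↓-◁ (V i) v≰f ∁↓f⊆V))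
           (λ _ → ⋂V⊆↑x)
      where
      ∁↓ : Carrier → Subset
      ∁↓ f z = Lift ℓ (¬ z ≤ f)
      -- Asking for `U ≡ ∁↓ f` would land in level `suc ℓ`. Upper sets that include `∁↓ f` keep the
      -- collection at level `ℓ`.
      𝒰 : Pred Subset ℓ
      𝒰 U = ∃ λ f → ¬ v ≤ f × IsUpper L U × (∀ {z} → ¬ z ≤ f → z ∈ U)
      ∁↓∈𝒰 : ∀ {f} → ¬ v ≤ f → ∁↓ f ∈ 𝒰
      ∁↓∈𝒰 v≰f = _ , v≰f , (λ (lift u≰f) u≤p → lift (u≰f ∘ trans u≤p)) , lift

    primeContinuous : JoinContinuous L → Hypercontinuous L → PrimeContinuous L
    primeContinuous jc hc v = ◁⇒≤ , λ b ◁⊆↓b → dne₂ λ v≰b →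
      v≰b (proj₂ (hc v) b λ x≺v → ≺-bound jc ◁⊆↓b x≺v v≰b)

    ◁-∨ : ∀ {u x y} → u ◁ᴸ x ∨ y → ¬ u ≤ x → u ≤ y
    ◁-∨ {u} {x} {y} u◁x∨y u≰x
      with u◁x∨y (λ z → Lift ℓ (z ≤ x) ⊎ Lift ℓ (z ≤ y))
                 (∨-least (⋁-upper _ (inj₁ (lift refl))) (⋁-upper _ (inj₂ (lift refl))))
    ... | _ , inj₁ (lift s≤x) , u≤s = ⊥-elim (u≰x (trans u≤s s≤x))
    ... | _ , inj₂ (lift s≤y) , u≤s = trans u≤s s≤y

    ◁-≤-trans : ∀ {u v w} → u ◁ᴸ v → v ≤ w → u ◁ᴸ w
    ◁-≤-trans u◁v v≤w S w≤⋁S = u◁v S (trans v≤w w≤⋁S)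

    -- An element `u ◁ ⋀ x∨S` is `◁` each `x ∨ s`. Unless `u ≤ x`, it is therefore below every
    -- `s ∈ S`, hence below `⋀ S`.
    joinContinuous : PrimeContinuous L → JoinContinuous L
    joinContinuous pc x S = antisym
      (⋀-greatest x∨S λ (s , s∈S , z≈x∨s) → trans
        (∨-least (x≤x∨y x s) (trans (⋀-lower S s∈S) (y≤x∨y x s)))
        (reflexive (Eq.sym z≈x∨s)))
      (proj₂ (pc (⋀ x∨S)) _ λ u◁⋀ → dne₂ λ u≰ → u≰ (trans
        (⋀-greatest S λ {s} s∈S → ◁-∨
          (◁-≤-trans u◁⋀ (⋀-lower x∨S (s , s∈S , Eq.refl)))
          (λ u≤x → u≰ (trans u≤x (x≤x∨y x (⋀ S)))))
        (y≤x∨y x (⋀ S))))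
      where
      x∨S : Subset
      x∨S z = ∃ λ s → s ∈ S × z ≈ x ∨ s

    -- One member suffices: as `v` is not below `m = ⋁ ∁↑u`, some `U ∈ 𝒰` omits `m`. Any `z ∈ U` not
    -- above `u` would satisfy `z ≤ m` and force `m ∈ U`.
    ◁⇒≺ : ∀ {u v} → u ◁ᴸ v → u ≺ᴸ v
    ◁⇒≺ {u} {v} u◁v 𝒰 _ upper ⋂𝒰⊆↑v = dne λ ¬finite →
      v≰m (⋂𝒰⊆↑v λ (U , U∈𝒰) → dneˡ λ m∉U → ¬finite
        (1 , (λ _ → U) , (λ _ → U∈𝒰) , λ {_} z∈U → dne₂ λ u≰z →
          m∉U (upper U∈𝒰 (z∈U Fin.zero) (⋁-upper ∁↑u (lift u≰z)))))
      where
      ∁↑u : Subset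
      ∁↑u z = Lift ℓ (¬ u ≤ z)
      v≰m : ¬ v ≤ ⋁ ∁↑u
      v≰m v≤m = let _ , lift u≰s , u≤s = u◁v ∁↑u v≤m in u≰s u≤s

    hypercontinuous : PrimeContinuous L → Hypercontinuous L
    hypercontinuous pc y = ≺⇒≤ , λ b ≺⊆↓b → proj₂ (pc y) b (≺⊆↓b ∘ ◁⇒≺)

theorem3p2 : ∀ {c ℓ₁ ℓ₂ : Level} →
    ExcludedMiddle (suc (c ⊔ ℓ₁ ⊔ ℓ₂)) →
    (L : CompleteLattice c ℓ₁ ℓ₂) →
    (JoinContinuous L × Hypercontinuous L) ⇔ PrimeContinuous L
theorem3p2 em L = mk⇔
  (λ (jc , hc) → primeContinuous L em jc hc)
  (λ pc → joinContinuous L em pc , hypercontinuous L em pc)
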